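{- Let $\mathbb{K}$ be a commutative ring with unit, $\mathsf{S}$ a minors system, $R$ a commutative $\mathbb{K}$-algebra, $N_0,N_1,N_2:\mathbb{K}\mathsf{S}\to R$ three norms and $\tau_1,\tau_2:\mathbb{K}\mathsf{S}\to R$ two twist maps. Then the Tutte characters satisfy the convolution formula $$T_{\overline{N_0},\tau_1\tau_2,N_2}=T_{\overline{N_0},\tau_1,N_1}*T_{\overline{N_1},\tau_2,N_2}.$$ In other words, for every finite set $E$ and every $X\in\mathsf{S}[E]$, $$T_{\overline{N_0},\tau_1\tau_2,N_2}(X)=\sum_{A\subseteq E}T_{\overline{N_0},\tau_1,N_1}(X|A)\,T_{\overline{N_1},\tau_2,N_2}(X/A).$$
   Context: A set species $\mathsf{S}$ is a functor from finite sets and bijections to sets; the linear species $\mathbb{K}\mathsf{S}$ sends $E$ to the free $\mathbb{K}$-module on $\mathsf{S}[E]$. A morphism of linear species $\mathbb{K}\mathsf{S}\to R$ is a family of linear maps $\mathbb{K}\mathsf{S}[E]\to R$ invariant under bijections of ground sets. A minors system is a set species $\mathsf{S}$ with, for every finite set $E$ and $A\subseteq E$, maps $\mathsf{S}[E]\to\mathsf{S}[A]$, $X\mapsto X|A$ (restriction) and $\mathsf{S}[E]\to \mathsf{S}[E\setminus A]$, $X\mapsto X/A$ (contraction), and maps $\mathsf{S}[E]\times\mathsf{S}[\varnothing]\to\mathsf{S}[E]$, $(X,Y)\mapsto X\oplus Y$ (direct sum), such that: restriction, contraction and $\oplus$ are compatible with bijections of ground sets; for disjoint $A,B\subseteq E$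 and $X\in\mathsf{S}[E]$: $(X|A\sqcup B)|A=X|A$, $(X/A)|B=(X|A\sqcup B)/A$, $(X/A)/B=X/(A\sqcup B)$; $X|E=X$ and $X/\varnothing=X$ for $X\in\mathsf{S}[E]$; $X\oplus(Y\oplus Z)=(X\oplus Y)\oplus Z$ for $X\in\mathsf{S}[E]$, $Y,Z\in\mathsf{S}[\varnothing]$; $X\oplus Y=Y\oplus X$ for $X,Y\in\mathsf{S}[\varnothing]$; there is $1_{\mathsf{S}}\in\mathsf{S}[\varnothing]$ with $X\oplus 1_{\mathsf{S}}=X$ for all $X\in \mathsf{S}[E]$; $(X\oplus Y)|A=(X|A)\oplus Y$ and $(X\oplus Y)/A=(X/A)\oplus Y$ for $X\in\mathsf{S}[E]$, $Y\in\mathsf{S}[\varnothing]$, $A\subseteq E$. In particular $\mathsf{S}[\varnothing]$ is a commutative monoid under $\oplus$. A norm $N:\mathbb{K}\mathsf{S}\to R$ is a morphism of linear species such that $N(X)=N(X|A)N(X/A)$ for $X\in\mathsf{S}[E]$, $A\subseteq E$; $N(X\oplus Y)=N(X)$ for $X\in\mathsf{S}[E]$, $Y\in\mathsf{S}[\varnothing]$; and $N(1_{\mathsf{S}})=1$. The inverse norm is $\overline{N}(X)=(-1)^{|E|}N(X)$ for $X\in\mathsf{S}[E]$. A twist map $\tau:\mathbb{K}\mathsf{S}\to R$ is given by a monoid morphism $\tau:\mathsf{S}[\varnothing]\to(R,\cdot)$, extended linearly, and by $0$ on $\mathsf{S}[E]$ for $E\neq\varnothing$. The product $\tau_1\tau_2$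 is the twist map given by the pointwise product on $\mathsf{S}[\varnothing]$. The convolution of $f,g:\mathbb{K}\mathsf{S}\to R$ is $(f*g)(X)=\sum_{A\subseteq E}f(X|A)\,g(X/A)$ for $X\in\mathsf{S}[E]$. For norms $N,N'$ and a twist map $\tau$, the Tutte character is $T_{N,\tau,N'}=N*\tau*N'$, i.e. $T_{N,\tau,N'}(X)=\sum_{A\subseteq E}N(X|A)\,\tau((X|A)/A)\,N'(X/A)$. -}

module Defs where

open import Algebra.Bundles using (CommutativeRing; RawMonoid)
open import Algebra.Module.Bundles using (Module)
open import Algebra.Module.Morphism.Structures using (IsModuleHomomorphism)
open import Algebra.Module.Structures using (IsModule)
open import Algebra.Module.Structures.Biased using (IsModuleFromLeft)
open import Algebra.Morphism.Structures using (IsMonoidHomomorphism)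
import Algebra.Properties.CommutativeMonoid.Sum as Sum
import Algebra.Properties.CommutativeSemigroup as CommutativeSemigroupProperties
import Algebra.Properties.Semiring.Exp as Exp
open import Data.Bool.Base using (Bool; true; false; not; _∧_; _∨_; T)
open import Data.Bool.Properties using (∧-zeroʳ)
open import Data.Empty using (⊥-elim)
open import Data.Fin.Base using (Fin; zero; suc; combine; finToFun; funToFin)
open import Data.Fin.Permutation using (Permutation; ↔⇒≡; _⟨$⟩ʳ_)
open import Data.Fin.Properties using (2↔Bool; funToFin-finToFin; finToFun-funToFin)
import Data.Fin.Subset as FS
open import Data.Irrelevant using ([_])
open import Data.Nat.Base using (ℕ; zero; suc; _+_; _^_)
import Data.Nat.Properties as ℕₚ
open import Data.Product.Base using (_,_)
open import Data.Refinement using (Refinement-syntax; value; _,_)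
open import Data.Unit.Base using (tt)
open import Data.Vec.Base using (tabulate; _∷_)
open import Function.Base using (_∘_; flip)
open import Function.Bundles using (_↔_; Inverse; mk↔ₛ′)
open import Function.Construct.Composition using (_↔-∘_)
open import Function.Construct.Identity using (↔-id)
open import Function.Construct.Symmetry using (↔-sym)
open import Level using (Level; _⊔_) renaming (suc to lsuc)
open import Relation.Binary.Bundles using (Setoid)
import Relation.Binary.PropositionalEquality as ≡
open import Relation.Binary.PropositionalEquality using (_≡_; _≗_; cong; cong₂; subst)
import Relation.Binary.Reasoning.Setoid as SetoidReasoning
open import Relation.Nullary.Decidable.Core using (Dec; yes; no)
open import Relation.Nullary.Negation.Core using (contradiction)

open Inverse using (to; from; strictlyInverseˡ; strictlyInverseʳ)

-- The enumeration witnesses finiteness.  It carries no information for a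
-- species, since the identity relates any two enumerations of a set.
record FinSet : Set₁ where
  field
    Elem : Set
    size    : ℕ
    enum    : Elem ↔ Fin size

open FinSet public

infix 4 _≅_

_≅_ : FinSet → FinSet → Set
E ≅ F = Elem E ↔ Elem F

∅ : FinSet
∅ = record { Elem = Fin 0 ; size = 0 ; enum = ↔-id (Fin 0) }

empty≅∅ : ∀ E → size E ≡ 0 → E ≅ ∅
empty≅∅ E p = subst (λ n → Elem E ↔ Fin n) p (enum E)

≅⇒size≡ : ∀ {E F} → E ≅ F → size E ≡ size F
≅⇒size≡ {E} {F} σ = ↔⇒≡ (enum F ↔-∘ (σ ↔-∘ ↔-sym (enum E)))

-- Subsets are compared by _≗_, so everything depending on a subset has to
-- respect pointwise equality.
Subset : FinSet → Set
Subset E = Elem E → Bool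

module _ {X : Set} where

  infixr 6 _∪_

  ∁ : (X → Bool) → (X → Bool)
  ∁ A e = not (A e)

  _∪_ : (X → Bool) → (X → Bool) → (X → Bool)
  (A ∪ B) e = A e ∨ B e

  Disjoint : (X → Bool) → (X → Bool) → Set
  Disjoint A B = ∀ e → A e ∧ B e ≡ false

  full none : X → Bool
  full _ = true
  none _ = false

  -- Q ∩ P as a subset of P.
  inside : (P Q : X → Bool) → [ e ∈ X ∣ T (P e) ] → Bool
  inside P Q = Q ∘ value

private
  enumHead : ∀ {n m} {P : Fin (suc n) → Bool} (p : FS.Subset m) (b : Bool) → P zero ≡ b →
             [ i ∈ Fin n ∣ T (P (suc i)) ] ↔ Fin FS.∣ p ∣ →
             [ i ∈ Fin (suc n) ∣ T (P i) ] ↔ Fin FS.∣ b ∷ p ∣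
  enumHead {P = P} p true eq e = mk↔ₛ′
    (λ { (zero , _) → zero ; (suc i , q) → suc (to e (i , q)) })
    (λ { zero → zero , [ subst T (≡.sym eq) tt ] ; (suc j) → shift (from e j) })
    (λ { zero → ≡.refl ; (suc j) → cong suc (strictlyInverseˡ e j) })
    (λ { (zero , _) → ≡.refl ; (suc i , q) → cong shift (strictlyInverseʳ e (i , q)) })
    where
    shift : [ i ∈ Fin _ ∣ T (P (suc i)) ] → [ i ∈ Fin _ ∣ T (P i) ]
    shift (i , q) = suc i , q
  enumHead {n} {m} {P} p false eq e = mk↔ₛ′ down up (strictlyInverseˡ e) up∘down
    where
    absurd : ∀ {a} {A : Set a} → .(T (P zero)) → A
    absurd q = ⊥-elim (subst T eq (recover q))
      where
      recover : .(T (P zero)) → T (P zero)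
      recover q with P zero
      ... | true  = tt
    down : [ i ∈ Fin (suc n) ∣ T (P i) ] → Fin FS.∣ p ∣
    down (zero , [ q ]) = absurd q
    down (suc i , q)    = to e (i , q)
    up : Fin FS.∣ p ∣ → [ i ∈ Fin (suc n) ∣ T (P i) ]
    up j with from e j
    ... | i , q = suc i , q
    shift : [ i ∈ Fin n ∣ T (P (suc i)) ] → [ i ∈ Fin (suc n) ∣ T (P i) ]
    shift (i , q) = suc i , q
    up∘down : ∀ x → up (down x) ≡ x
    up∘down (zero , [ q ]) = absurd q
    up∘down (suc i , q)    = cong shift (strictlyInverseʳ e (i , q))

  enumFin : ∀ {n} (P : Fin n → Bool) → [ i ∈ Fin n ∣ T (P i) ] ↔ Fin FS.∣ tabulate P ∣
  enumFin {zero}  P = mk↔ₛ′ (λ { (() , _) }) (λ ()) (λ ()) (λ { (() , _) })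
  enumFin {suc n} P = enumHead (tabulate (P ∘ suc)) (P zero) ≡.refl (enumFin (P ∘ suc))

  ∣P∣+∣∁P∣≡n : ∀ {n} (P : Fin n → Bool) →
              FS.∣ tabulate P ∣ + FS.∣ tabulate (not ∘ P) ∣ ≡ n
  ∣P∣+∣∁P∣≡n {zero}  P = ≡.refl
  ∣P∣+∣∁P∣≡n {suc n} P with P zero
  ... | true  = cong suc (∣P∣+∣∁P∣≡n (P ∘ suc))
  ... | false = ≡.trans (ℕₚ.+-suc _ _) (cong suc (∣P∣+∣∁P∣≡n (P ∘ suc)))

-- A subset regarded as a finite set in its own right.
Sub : (E : FinSet) → Subset E → FinSet
Sub E A = record
  { Elem = [ e ∈ Elem E ∣ T (A e) ]
  ; size    = FS.∣ tabulate (A ∘ from (enum E)) ∣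
  ; enum    = enumFin (A ∘ from (enum E)) ↔-∘ mk↔ₛ′
      (λ { (e , [ p ]) → to (enum E) e , [ subst (T ∘ A) (≡.sym (strictlyInverseʳ (enum E) e)) p ] })
      (λ { (i , p) → from (enum E) i , p })
      (λ { (i , p) → ext (strictlyInverseˡ (enum E) i) })
      (λ { (e , p) → ext (strictlyInverseʳ (enum E) e) })
  }
  where
  ext : ∀ {X : Set} {P : X → Set} {x y : [ e ∈ X ∣ P e ]} → value x ≡ value y → x ≡ y
  ext ≡.refl = ≡.refl

size-Sub : ∀ E (A : Subset E) → size (Sub E A) + size (Sub E (∁ A)) ≡ size E
size-Sub E A = ∣P∣+∣∁P∣≡n (A ∘ from (enum E))

-- The bijection A → B induced by σ when σ(A) = B.
restrict≅ : ∀ {E F} (σ : E ≅ F) (A : Subset E) (B : Subset F) →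
            A ≗ B ∘ to σ → Sub E A ≅ Sub F B
restrict≅ {E} {F} σ A B h = mk↔ₛ′
  (λ { (e , [ p ]) → to σ e , [ subst T (h e) p ] })
  (λ { (f , [ p ]) → from σ f , [ subst T (h' f) p ] })
  (λ { (f , p) → ext (strictlyInverseˡ σ f) })
  (λ { (e , p) → ext (strictlyInverseʳ σ e) })
  where
  h' : ∀ f → B f ≡ A (from σ f)
  h' f = ≡.sym (≡.trans (h (from σ f)) (cong B (strictlyInverseˡ σ f)))
  ext : ∀ {X : Set} {P : X → Set} {x y : [ e ∈ X ∣ P e ]} → value x ≡ value y → x ≡ y
  ext ≡.refl = ≡.refl

-- In set theory the following two are equalities of sets: both bijections are
-- the identity on underlying elements of E.
nested≅ : ∀ E (P Q C : Subset E) → (∀ e → P e ∧ Q e ≡ C e) →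
          Sub (Sub E P) (inside P Q) ≅ Sub E C
nested≅ E P Q C h = mk↔ₛ′
  (λ { ((e , [ p ]) , [ q ]) → e , [ subst T (h e) (∧⁺ (P e) (Q e) p q) ] })
  (λ { (e , [ c ]) → (e , [ ∧ˡ (P e) (Q e) (subst T (≡.sym (h e)) c) ])
                        , [ ∧ʳ (P e) (Q e) (subst T (≡.sym (h e)) c) ] })
  (λ _ → ≡.refl) (λ _ → ≡.refl)
  where
  ∧⁺ : ∀ a b → T a → T b → T (a ∧ b)
  ∧⁺ true b _ q = q
  ∧ˡ : ∀ a b → T (a ∧ b) → T a
  ∧ˡ true b _ = tt
  ∧ʳ : ∀ a b → T (a ∧ b) → T b
  ∧ʳ true b q = q

whole≅ : ∀ E (C : Subset E) → (∀ e → C e ≡ true) → Sub E C ≅ E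
whole≅ E C h = mk↔ₛ′ value (λ e → e , [ subst T (≡.sym (h e)) tt ])
  (λ _ → ≡.refl) (λ _ → ≡.refl)

private
  ∨-∧-absorb : ∀ a b → (a ∨ b) ∧ a ≡ a
  ∨-∧-absorb true  b = ≡.refl
  ∨-∧-absorb false b = ∧-zeroʳ b

  not-∧-disjoint : ∀ a b → a ∧ b ≡ false → not a ∧ b ≡ b
  not-∧-disjoint true  b d = ≡.sym d
  not-∧-disjoint false b d = ≡.refl

  ∨-∧-not-disjoint : ∀ a b → a ∧ b ≡ false → (a ∨ b) ∧ not a ≡ b
  ∨-∧-not-disjoint true  b     d = ≡.sym d
  ∨-∧-not-disjoint false true  d = ≡.refl
  ∨-∧-not-disjoint false false d = ≡.refl

  not-∧-not : ∀ a b → not a ∧ not b ≡ not (a ∨ b)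
  not-∧-not true  b = ≡.refl
  not-∧-not false b = ≡.refl

-- For A ∩ B = ∅, in order:  A viewed in A ∪ B;  B viewed in E ∖ A;
-- (A ∪ B) ∖ A as B;  (E ∖ A) ∖ B as E ∖ (A ∪ B).
module _ (E : FinSet) (A B : Subset E) (d : Disjoint A B) where

  in∪≅ : Sub (Sub E (A ∪ B)) (inside (A ∪ B) A) ≅ Sub E A
  in∪≅ = nested≅ E _ A A (λ e → ∨-∧-absorb (A e) (B e))

  in∁≅ : Sub (Sub E (∁ A)) (inside (∁ A) B) ≅ Sub E B
  in∁≅ = nested≅ E _ B B (λ e → not-∧-disjoint (A e) (B e) (d e))

  ∪∖≅ : Sub (Sub E (A ∪ B)) (inside (A ∪ B) (∁ A)) ≅ Sub E B
  ∪∖≅ = nested≅ E _ (∁ A) B (λ e → ∨-∧-not-disjoint (A e) (B e) (d e))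

  ∖∖≅ : Sub (Sub E (∁ A)) (inside (∁ A) (∁ B)) ≅ Sub E (∁ (A ∪ B))
  ∖∖≅ = nested≅ E _ (∁ B) _ (λ e → not-∧-not (A e) (B e))

record Species (s ℓ : Level) : Set (lsuc (lsuc Level.zero ⊔ s ⊔ ℓ)) where
  field
    on           : FinSet → Setoid s ℓ

  Str : FinSet → Set s
  Str E = Setoid.Carrier (on E)

  infix 4 _≈ˢ_
  _≈ˢ_ : ∀ {E} → Str E → Str E → Set ℓ
  _≈ˢ_ {E} = Setoid._≈_ (on E)

  field
    relabel      : ∀ {E F} → E ≅ F → Str E → Str F
    relabel-cong : ∀ {E F} {σ ρ : E ≅ F} {X Y : Str E} →
                   to σ ≗ to ρ → X ≈ˢ Y → relabel {E} {F} σ X ≈ˢ relabel {E} {F} ρ Y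
    relabel-id   : ∀ {E} (X : Str E) → relabel {E} {E} (↔-id (Elem E)) X ≈ˢ X
    relabel-∘    : ∀ {E F G} (ρ : F ≅ G) (σ : E ≅ F) (X : Str E) →
                   relabel {E} {G} (ρ ↔-∘ σ) X ≈ˢ relabel {F} {G} ρ (relabel {E} {F} σ X)

record MinorsSystem (s ℓ : Level) : Set (lsuc (lsuc Level.zero ⊔ s ⊔ ℓ)) where
  infixl 8 _∣_ _/_
  infixl 7 _⊕_

  field
    species : Species s ℓ

  open Species species public

  field
    _∣_     : ∀ {E} → Str E → (A : Subset E) → Str (Sub E A)
    _/_     : ∀ {E} → Str E → (A : Subset E) → Str (Sub E (∁ A))
    _⊕_     : ∀ {E} → Str E → Str ∅ → Str E
    1ˢ      : Str ∅

    ∣-cong  : ∀ {E} (A : Subset E) {X Y : Str E} → X ≈ˢ Y → X ∣ A ≈ˢ Y ∣ A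
    /-cong  : ∀ {E} (A : Subset E) {X Y : Str E} → X ≈ˢ Y → X / A ≈ˢ Y / A
    ⊕-cong  : ∀ {E} {X X′ : Str E} {Y Y′ : Str ∅} → X ≈ˢ X′ → Y ≈ˢ Y′ → X ⊕ Y ≈ˢ X′ ⊕ Y′

    -- Stated for any B with σ(A) = B; for σ the identity this says that
    -- minors depend only on the elements of A.
    ∣-relabel : ∀ {E F} (σ : E ≅ F) (A : Subset E) (B : Subset F) (h : A ≗ B ∘ to σ) (X : Str E) →
                relabel {Sub E A} {Sub F B} (restrict≅ {E} {F} σ A B h) (X ∣ A)
                  ≈ˢ relabel {E} {F} σ X ∣ B
    /-relabel : ∀ {E F} (σ : E ≅ F) (A : Subset E) (B : Subset F) (h : A ≗ B ∘ to σ) (X : Str E) →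
                relabel {Sub E (∁ A)} {Sub F (∁ B)}
                        (restrict≅ {E} {F} σ (∁ A) (∁ B) (cong not ∘ h)) (X / A)
                  ≈ˢ relabel {E} {F} σ X / B
    ⊕-relabel : ∀ {E F} (σ : E ≅ F) (X : Str E) (Y : Str ∅) →
                relabel {E} {F} σ (X ⊕ Y) ≈ˢ relabel {E} {F} σ X ⊕ Y

    ∣-∣     : ∀ {E} (A B : Subset E) (d : Disjoint A B) (X : Str E) →
              relabel (in∪≅ E A B d) (X ∣ (A ∪ B) ∣ inside (A ∪ B) A) ≈ˢ X ∣ A
    /-∣     : ∀ {E} (A B : Subset E) (d : Disjoint A B) (X : Str E) →
              relabel {_} {Sub E B} (in∁≅ E A B d) (X / A ∣ inside (∁ A) B)
                ≈ˢ relabel (∪∖≅ E A B d) (X ∣ (A ∪ B) / inside (A ∪ B) A)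
    /-/     : ∀ {E} (A B : Subset E) (d : Disjoint A B) (X : Str E) →
              relabel (∖∖≅ E A B d) (X / A / inside (∁ A) B) ≈ˢ X / (A ∪ B)
    ∣-full  : ∀ {E} (X : Str E) → relabel (whole≅ E full (λ _ → ≡.refl)) (X ∣ full) ≈ˢ X
    /-none  : ∀ {E} (X : Str E) →
              relabel (whole≅ E (∁ none) (λ _ → ≡.refl)) (X / none) ≈ˢ X

    ⊕-assoc     : ∀ {E} (X : Str E) (Y Z : Str ∅) → X ⊕ (Y ⊕ Z) ≈ˢ (X ⊕ Y) ⊕ Z
    ⊕-comm      : ∀ (X Y : Str ∅) → X ⊕ Y ≈ˢ Y ⊕ X
    ⊕-identityʳ : ∀ {E} (X : Str E) → X ⊕ 1ˢ ≈ˢ X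
    ⊕-∣         : ∀ {E} (X : Str E) (Y : Str ∅) (A : Subset E) → (X ⊕ Y) ∣ A ≈ˢ (X ∣ A) ⊕ Y
    ⊕-/         : ∀ {E} (X : Str E) (Y : Str ∅) (A : Subset E) → (X ⊕ Y) / A ≈ˢ (X / A) ⊕ Y

  ∅-rawMonoid : RawMonoid s ℓ
  ∅-rawMonoid = record { Carrier = Str ∅ ; _≈_ = _≈ˢ_ {∅} ; _∙_ = _⊕_ ; ε = 1ˢ }

record CommutativeAlgebra {k ℓk} (K : CommutativeRing k ℓk) (r ℓ : Level)
       : Set (k ⊔ ℓk ⊔ lsuc (r ⊔ ℓ)) where
  infixr 7 _·_
  field
    commutativeRing : CommutativeRing r ℓ

  open CommutativeRing commutativeRing public

  field
    _·_      : CommutativeRing.Carrier K → Carrier → Carrier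
    isModule : IsModule K _≈_ (CommutativeRing._+_ commutativeRing) 0# (-_) _·_ (flip _·_)
    ·-*      : ∀ c x y → c · (x * y) ≈ (c · x) * y

  asModule : Module K r ℓ
  asModule = record { isModule = isModule }

-- The free K-module on X: formal expressions in the generators, modulo the
-- smallest congruence that contains the equality of X and makes them a module.
module Free {k ℓk x ℓx} (K : CommutativeRing k ℓk) (X : Setoid x ℓx) where

  private
    module K = CommutativeRing K
    module X = Setoid X

  infixl 6 _⊞_
  infixr 7 _⊡_
  infixr 8 ⊟_
  infix 4 _≈ᶠ_

  data Comb : Set (k ⊔ x) where
    ⟨_⟩ : X.Carrier → Comb
    𝟘   : Comb
    _⊞_ : Comb → Comb → Comb
    ⊟_  : Comb → Comb
    _⊡_ : K.Carrier → Comb → Comb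

  data _≈ᶠ_ : Comb → Comb → Set (k ⊔ ℓk ⊔ x ⊔ ℓx) where
    ≈-refl  : ∀ {u} → u ≈ᶠ u
    ≈-sym   : ∀ {u v} → u ≈ᶠ v → v ≈ᶠ u
    ≈-trans : ∀ {u v w} → u ≈ᶠ v → v ≈ᶠ w → u ≈ᶠ w
    ⟨⟩-cong : ∀ {a b} → a X.≈ b → ⟨ a ⟩ ≈ᶠ ⟨ b ⟩
    ⊞-cong  : ∀ {u u′ v v′} → u ≈ᶠ u′ → v ≈ᶠ v′ → u ⊞ v ≈ᶠ u′ ⊞ v′
    ⊟-cong  : ∀ {u v} → u ≈ᶠ v → ⊟ u ≈ᶠ ⊟ v
    ⊡-cong  : ∀ {c d u v} → c K.≈ d → u ≈ᶠ v → c ⊡ u ≈ᶠ d ⊡ v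
    ⊞-assoc     : ∀ u v w → (u ⊞ v) ⊞ w ≈ᶠ u ⊞ (v ⊞ w)
    ⊞-comm      : ∀ u v → u ⊞ v ≈ᶠ v ⊞ u
    ⊞-identityˡ : ∀ u → 𝟘 ⊞ u ≈ᶠ u
    ⊟-inverseˡ  : ∀ u → (⊟ u) ⊞ u ≈ᶠ 𝟘
    ⊡-zeroˡ     : ∀ u → K.0# ⊡ u ≈ᶠ 𝟘
    ⊡-zeroʳ     : ∀ c → c ⊡ 𝟘 ≈ᶠ 𝟘
    ⊡-identityˡ : ∀ u → K.1# ⊡ u ≈ᶠ u
    ⊡-assoc     : ∀ c d u → (c K.* d) ⊡ u ≈ᶠ c ⊡ (d ⊡ u)
    ⊡-distribˡ  : ∀ c u v → c ⊡ (u ⊞ v) ≈ᶠ c ⊡ u ⊞ c ⊡ v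
    ⊡-distribʳ  : ∀ u c d → (c K.+ d) ⊡ u ≈ᶠ c ⊡ u ⊞ d ⊡ u

  freeModule : Module K (k ⊔ x) (k ⊔ ℓk ⊔ x ⊔ ℓx)
  freeModule = record
    { Carrierᴹ = Comb ; _≈ᴹ_ = _≈ᶠ_ ; _+ᴹ_ = _⊞_ ; _*ₗ_ = _⊡_ ; _*ᵣ_ = flip _⊡_
    ; 0ᴹ = 𝟘 ; -ᴹ_ = ⊟_
    ; isModule = IsModuleFromLeft.isModule {commutativeRing = K} (record { isLeftModule = record
      { isLeftSemimodule = record
        { +ᴹ-isCommutativeMonoid = record
          { isMonoid = record
            { isSemigroup = record
              { isMagma = record
                { isEquivalence = record { refl = ≈-refl ; sym = ≈-sym ; trans = ≈-trans }
                ; ∙-cong = ⊞-cong }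
              ; assoc = ⊞-assoc }
            ; identity = ⊞-identityˡ , λ u → ≈-trans (⊞-comm u 𝟘) (⊞-identityˡ u) }
          ; comm = ⊞-comm }
        ; isPreleftSemimodule = record
          { *ₗ-cong = ⊡-cong ; *ₗ-zeroˡ = ⊡-zeroˡ ; *ₗ-distribʳ = ⊡-distribʳ
          ; *ₗ-identityˡ = ⊡-identityˡ ; *ₗ-assoc = ⊡-assoc ; *ₗ-zeroʳ = ⊡-zeroʳ
          ; *ₗ-distribˡ = ⊡-distribˡ } }
      ; -ᴹ‿cong = ⊟-cong
      ; -ᴹ‿inverse = ⊟-inverseˡ , λ u → ≈-trans (⊞-comm u (⊟ u)) (⊟-inverseˡ u) } })
    }

  module _ {m ℓm} (M : Module K m ℓm) where
    open Module M

    extend : (X.Carrier → Carrierᴹ) → Comb → Carrierᴹ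
    extend f ⟨ a ⟩   = f a
    extend f 𝟘       = 0ᴹ
    extend f (u ⊞ v) = extend f u +ᴹ extend f v
    extend f (⊟ u)   = -ᴹ extend f u
    extend f (c ⊡ u) = c *ₗ extend f u

    extend-cong : ∀ {f} → (∀ {a b} → a X.≈ b → f a ≈ᴹ f b) →
                  ∀ {u v} → u ≈ᶠ v → extend f u ≈ᴹ extend f v
    extend-cong p ≈-refl            = ≈ᴹ-refl
    extend-cong p (≈-sym e)         = ≈ᴹ-sym (extend-cong p e)
    extend-cong p (≈-trans e e′)    = ≈ᴹ-trans (extend-cong p e) (extend-cong p e′)
    extend-cong p (⟨⟩-cong e)       = p e
    extend-cong p (⊞-cong e e′)     = +ᴹ-cong (extend-cong p e) (extend-cong p e′)
    extend-cong p (⊟-cong e)        = -ᴹ‿cong (extend-cong p e)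
    extend-cong p (⊡-cong c e)      = *ₗ-cong c (extend-cong p e)
    extend-cong p (⊞-assoc u v w)   = +ᴹ-assoc _ _ _
    extend-cong p (⊞-comm u v)      = +ᴹ-comm _ _
    extend-cong p (⊞-identityˡ u)   = +ᴹ-identityˡ _
    extend-cong p (⊟-inverseˡ u)    = -ᴹ‿inverseˡ _
    extend-cong p (⊡-zeroˡ u)       = *ₗ-zeroˡ _
    extend-cong p (⊡-zeroʳ c)       = *ₗ-zeroʳ _
    extend-cong p (⊡-identityˡ u)   = *ₗ-identityˡ _
    extend-cong p (⊡-assoc c d u)   = *ₗ-assoc _ _ _
    extend-cong p (⊡-distribˡ c u v) = *ₗ-distribˡ _ _ _
    extend-cong p (⊡-distribʳ u c d) = *ₗ-distribʳ _ _ _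

    extend-isHomomorphism : ∀ {f} → (∀ {a b} → a X.≈ b → f a ≈ᴹ f b) →
      IsModuleHomomorphism (Module.rawModule freeModule) rawModule (extend f)
    extend-isHomomorphism p = record { isBimoduleHomomorphism = record
      { +ᴹ-isGroupHomomorphism = record
        { isMonoidHomomorphism = record
          { isMagmaHomomorphism = record
            { isRelHomomorphism = record { cong = extend-cong p }
            ; homo = λ _ _ → ≈ᴹ-refl }
          ; ε-homo = ≈ᴹ-refl }
        ; ⁻¹-homo = λ _ → ≈ᴹ-refl }
      ; *ₗ-homo = λ _ _ → ≈ᴹ-refl
      ; *ᵣ-homo = λ c u → *ₗ-*ᵣ-coincident c _ } }

module TutteCharacters
  {k ℓk s ℓs r ℓr} (K : CommutativeRing k ℓk) (S : MinorsSystem s ℓs)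
  (R : CommutativeAlgebra K r ℓr) where

  open MinorsSystem S public using (Str; _∣_; _/_)
  open MinorsSystem S hiding (Str; _∣_; _/_)
  open CommutativeAlgebra R public
    using (_≈_; 0#; 1#; _*_; -_)
    renaming (Carrier to ∣R∣)

  private
    module R = CommutativeAlgebra R
    module RM = Module R.asModule
    module Exponent = Exp R.semiring
    open Sum R.+-commutativeMonoid using (sum; ∑-permute; sum-cong-≋)
    open CommutativeSemigroupProperties R.*-commutativeSemigroup using (interchange)
    open Exponent using (^-homo-*; ^-congʳ) renaming (_^_ to _↑_)

  -- The sum runs over Fin (2 ^ size E), whose elements code the maps from
  -- positions in the enumeration of E to Fin 2.

  nthSubset : ∀ E → Fin (2 ^ size E) → Subset E
  nthSubset E i e = to 2↔Bool (finToFun i (to (enum E) e))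

  infixl 5 ∑⊆-syntax

  ∑⊆ : (E : FinSet) → (Subset E → ∣R∣) → ∣R∣
  ∑⊆ E f = sum (λ (i : Fin (2 ^ size E)) → f (nthSubset E i))

  ∑⊆-syntax : (E : FinSet) → (Subset E → ∣R∣) → ∣R∣
  ∑⊆-syntax = ∑⊆

  syntax ∑⊆-syntax E (λ A → x) = ∑[ A ⊆ E ] x

  private
    funToFin-cong : ∀ {m n} {f g : Fin m → Fin n} → f ≗ g → funToFin f ≡ funToFin g
    funToFin-cong {zero}  h = ≡.refl
    funToFin-cong {suc m} h = cong₂ combine (h zero) (funToFin-cong (h ∘ suc))

  indexOf : ∀ E → Subset E → Fin (2 ^ size E)
  indexOf E A = funToFin (from 2↔Bool ∘ A ∘ from (enum E))

  indexOf-cong : ∀ E {A B : Subset E} → A ≗ B → indexOf E A ≡ indexOf E B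
  indexOf-cong E h = funToFin-cong (λ i → cong (from 2↔Bool) (h (from (enum E) i)))

  nthSubset-indexOf : ∀ E (A : Subset E) → nthSubset E (indexOf E A) ≗ A
  nthSubset-indexOf E A e = ≡.trans
    (cong (to 2↔Bool) (finToFun-funToFin (from 2↔Bool ∘ A ∘ from (enum E)) (to (enum E) e)))
    (≡.trans (strictlyInverseˡ 2↔Bool _) (cong A (strictlyInverseʳ (enum E) e)))

  indexOf-nthSubset : ∀ E i → indexOf E (nthSubset E i) ≡ i
  indexOf-nthSubset E i = ≡.trans
    (funToFin-cong (λ j → ≡.trans (strictlyInverseʳ 2↔Bool _)
                                  (cong (finToFun i) (strictlyInverseˡ (enum E) j))))
    (funToFin-finToFin {size E} {2} i)

  ∑⊆-relabel : ∀ {E F} (σ : E ≅ F) (f : Subset E → ∣R∣) (g : Subset F → ∣R∣) →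
               (∀ A B → A ≗ B ∘ to σ → f A ≈ g B) → ∑⊆ E f ≈ ∑⊆ F g
  ∑⊆-relabel {E} {F} σ f g h = R.trans
    (sum-cong-≋ (λ i → h (nthSubset E i) (nthSubset F (π ⟨$⟩ʳ i)) (λ e → ≡.sym (image i e))))
    (R.sym (∑-permute (g ∘ nthSubset F) π))
    where
    image : ∀ i e → nthSubset F (indexOf F (nthSubset E i ∘ from σ)) (to σ e) ≡ nthSubset E i e
    image i e = ≡.trans (nthSubset-indexOf F (nthSubset E i ∘ from σ) (to σ e))
                        (cong (nthSubset E i) (strictlyInverseʳ σ e))
    preimage : ∀ j f → nthSubset E (indexOf E (nthSubset F j ∘ to σ)) (from σ f) ≡ nthSubset F j f
    preimage j f = ≡.trans (nthSubset-indexOf E (nthSubset F j ∘ to σ) (from σ f))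
                           (cong (nthSubset F j) (strictlyInverseˡ σ f))
    π : Permutation (2 ^ size E) (2 ^ size F)
    π = mk↔ₛ′ (λ i → indexOf F (nthSubset E i ∘ from σ)) (λ j → indexOf E (nthSubset F j ∘ to σ))
      (λ j → ≡.trans (indexOf-cong F (preimage j)) (indexOf-nthSubset F j))
      (λ i → ≡.trans (indexOf-cong E (image i)) (indexOf-nthSubset E i))

  KS : FinSet → Module K (k ⊔ s) (k ⊔ ℓk ⊔ s ⊔ ℓs)
  KS E = Free.freeModule K (on E)

  ∣KS∣ : FinSet → Set (k ⊔ s)
  ∣KS∣ E = Module.Carrierᴹ (KS E)

  ⟨_⟩ : ∀ {E} → Str E → ∣KS∣ E
  ⟨_⟩ = Free.⟨_⟩

  KS-relabel : ∀ {E F} → E ≅ F → ∣KS∣ E → ∣KS∣ F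
  KS-relabel {E} {F} σ = Free.extend K (on E) (KS F) (λ X → ⟨_⟩ {F} (relabel {E} {F} σ X))

  record Morphism : Set (lsuc Level.zero ⊔ k ⊔ ℓk ⊔ s ⊔ ℓs ⊔ r ⊔ ℓr) where
    field
      ⟦_⟧       : ∀ {E} → ∣KS∣ E → ∣R∣
      linear    : ∀ {E} → IsModuleHomomorphism (Module.rawModule (KS E))
                                                (Module.rawModule R.asModule) (⟦_⟧ {E})
      invariant : ∀ {E F} (σ : E ≅ F) (u : ∣KS∣ E) →
                  ⟦_⟧ {F} (KS-relabel {E} {F} σ u) ≈ ⟦_⟧ {E} u

    value-at : ∀ {E} → Str E → ∣R∣
    value-at {E} X = ⟦_⟧ {E} ⟨ X ⟩

    value-cong : ∀ {E} {X Y : Str E} → X ≈ˢ Y → value-at {E} X ≈ value-at {E} Y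
    value-cong {E} p = IsModuleHomomorphism.⟦⟧-cong (linear {E}) (Free.⟨⟩-cong p)

    value-relabel : ∀ {E F} (σ : E ≅ F) {X : Str E} {Y : Str F} →
                    relabel {E} {F} σ X ≈ˢ Y → value-at {E} X ≈ value-at {F} Y
    value-relabel {E} {F} σ {X} p = R.trans (R.sym (invariant {E} {F} σ ⟨ X ⟩)) (value-cong {F} p)

  infixl 9 _at_
  _at_ : Morphism → ∀ {E} → Str E → ∣R∣
  (f at X) = Morphism.value-at f X

  infix 4 _≋_
  _≋_ : Morphism → Morphism → Set (lsuc Level.zero ⊔ k ⊔ s ⊔ ℓr)
  f ≋ g = ∀ E (u : ∣KS∣ E) → Morphism.⟦_⟧ f u ≈ Morphism.⟦_⟧ g u

  linearise : (f : ∀ E → Str E → ∣R∣) →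
              (∀ {E} {X Y : Str E} → X ≈ˢ Y → f E X ≈ f E Y) →
              (∀ {E F} (σ : E ≅ F) (X : Str E) → f E X ≈ f F (relabel {E} {F} σ X)) →
              Morphism
  linearise f f-cong f-inv = record
    { ⟦_⟧       = λ {E} → ext E
    ; linear    = λ {E} → Free.extend-isHomomorphism K (on E) R.asModule f-cong
    ; invariant = inv
    }
    where
    ext : ∀ E → ∣KS∣ E → ∣R∣
    ext E = Free.extend K (on E) R.asModule (f E)
    inv : ∀ {E F} (σ : E ≅ F) (u : ∣KS∣ E) → ext F (KS-relabel {E} {F} σ u) ≈ ext E u
    inv σ Free.⟨ X ⟩     = R.sym (f-inv σ X)
    inv σ Free.𝟘         = R.refl
    inv {E} {F} σ (u Free.⊞ v) = R.+-cong (inv {E} {F} σ u) (inv {E} {F} σ v)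
    inv {E} {F} σ (Free.⊟ u)   = R.-‿cong (inv {E} {F} σ u)
    inv {E} {F} σ (c Free.⊡ u) = RM.*ₗ-congˡ (inv {E} {F} σ u)

  infixl 7 _⋆_
  _⋆_ : Morphism → Morphism → Morphism
  f ⋆ g = linearise
    (λ E X → ∑[ A ⊆ E ] (f at (X ∣ A) * g at (X / A)))
    (λ {E} {X} {Y} p → sum-cong-≋ (λ i → R.*-cong
      (F.value-cong {Sub E (nthSubset E i)} (∣-cong {E} (nthSubset E i) p))
      (G.value-cong {Sub E (∁ (nthSubset E i))} (/-cong {E} (nthSubset E i) p))))
    (λ {E} {F} σ X → ∑⊆-relabel {E} {F} σ _ _ (λ A B h → R.*-cong
      (F.value-relabel {Sub E A} {Sub F B} _ (∣-relabel {E} {F} σ A B h X))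
      (G.value-relabel {Sub E (∁ A)} {Sub F (∁ B)} _ (/-relabel {E} {F} σ A B h X))))
    where
    module F = Morphism f
    module G = Morphism g

  record Norm : Set (lsuc Level.zero ⊔ k ⊔ ℓk ⊔ s ⊔ ℓs ⊔ r ⊔ ℓr) where
    field
      morphism       : Morphism
      multiplicative : ∀ {E} (X : Str E) (A : Subset E) →
                       morphism at X ≈ morphism at (X ∣ A) * morphism at (X / A)
      ⊕-invariant    : ∀ {E} (X : Str E) (Y : Str ∅) → morphism at (X ⊕ Y) ≈ morphism at X
      normalised     : morphism at 1ˢ ≈ 1#

  inverse : Norm → Norm
  inverse N = record
    { morphism       = morphism⁻
    ; multiplicative = λ {E} X A → begin
        sign E * N.morphism at X
          ≈⟨ R.*-cong (sign-Sub E A) (N.multiplicative {E} X A) ⟩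
        (sign (Sub E A) * sign (Sub E (∁ A))) * (N.morphism at (X ∣ A) * N.morphism at (X / A))
          ≈⟨ interchange _ _ _ _ ⟩
        (sign (Sub E A) * N.morphism at (X ∣ A)) * (sign (Sub E (∁ A)) * N.morphism at (X / A)) ∎
    ; ⊕-invariant    = λ {E} X Y → R.*-congˡ (N.⊕-invariant {E} X Y)
    ; normalised     = R.trans (R.*-identityˡ _) N.normalised
    }
    where
    open SetoidReasoning R.setoid
    module N = Norm N
    module M = Morphism N.morphism
    sign : FinSet → ∣R∣
    sign E = (- 1#) ↑ size E
    sign-Sub : ∀ E (A : Subset E) → sign E ≈ sign (Sub E A) * sign (Sub E (∁ A))
    sign-Sub E A = R.trans (^-congʳ (- 1#) (≡.sym (size-Sub E A)))
                           (^-homo-* (- 1#) (size (Sub E A)) (size (Sub E (∁ A))))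
    morphism⁻ : Morphism
    morphism⁻ = linearise (λ E X → sign E * N.morphism at X)
      (λ {E} p → R.*-congˡ (M.value-cong {E} p))
      (λ {E} {F} σ X → R.*-cong (^-congʳ (- 1#) (≅⇒size≡ {E} {F} σ))
        (M.value-relabel {E} {F} σ (Setoid.refl (on F))))

  record TwistMap : Set (s ⊔ ℓs ⊔ r ⊔ ℓr) where
    field
      onEmpty              : Str ∅ → ∣R∣
      isMonoidHomomorphism : IsMonoidHomomorphism ∅-rawMonoid R.*-rawMonoid onEmpty

  -- Any empty ground set E has a unique bijection to ∅, along which S[E] is
  -- identified with S[∅].
  twist : TwistMap → Morphism
  twist τ = linearise (λ E → atDec E (size E ℕₚ.≟ 0))
    (λ {E} → atDec-cong E (size E ℕₚ.≟ 0))
    (λ {E} {F} σ X → atDec-relabel E F (size E ℕₚ.≟ 0) (size F ℕₚ.≟ 0) σ X)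
    where
    open TwistMap τ
    open IsMonoidHomomorphism isMonoidHomomorphism using (⟦⟧-cong)
    atDec : ∀ E → Dec (size E ≡ 0) → Str E → ∣R∣
    atDec E (yes p) X = onEmpty (relabel {E} {∅} (empty≅∅ E p) X)
    atDec E (no _)  X = 0#
    atDec-cong : ∀ E d {X Y : Str E} → X ≈ˢ Y → atDec E d X ≈ atDec E d Y
    atDec-cong E (yes p) e = ⟦⟧-cong (relabel-cong {E} {∅} (λ _ → ≡.refl) e)
    atDec-cong E (no _)  e = R.refl
    atDec-relabel : ∀ E F d d′ (σ : E ≅ F) X → atDec E d X ≈ atDec F d′ (relabel {E} {F} σ X)
    atDec-relabel E F (yes p) (yes q) σ X = ⟦⟧-cong (Setoid.trans (on ∅)
      (relabel-cong {E} {∅} {empty≅∅ E p} {empty≅∅ F q ↔-∘ σ} unique (Setoid.refl (on E)))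
      (relabel-∘ {E} {F} {∅} (empty≅∅ F q) σ X))
      where
      unique : to (empty≅∅ E p) ≗ to (empty≅∅ F q ↔-∘ σ)
      unique e with to (empty≅∅ E p) e
      ... | ()
    atDec-relabel E F (yes p) (no ¬q) σ X = contradiction (≡.trans (≡.sym (≅⇒size≡ {E} {F} σ)) p) ¬q
    atDec-relabel E F (no ¬p) (yes q) σ X = contradiction (≡.trans (≅⇒size≡ {E} {F} σ) q) ¬p
    atDec-relabel E F (no _)  (no _)  σ X = R.refl

  infixl 7 _∙_
  _∙_ : TwistMap → TwistMap → TwistMap
  τ₁ ∙ τ₂ = record
    { onEmpty = λ X → τ₁.onEmpty X * τ₂.onEmpty X
    ; isMonoidHomomorphism = record
      { isMagmaHomomorphism = record
        { isRelHomomorphism = record { cong = λ p → R.*-cong (H₁.⟦⟧-cong p) (H₂.⟦⟧-cong p) }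
        ; homo = λ X Y → R.trans (R.*-cong (H₁.homo X Y) (H₂.homo X Y)) (interchange _ _ _ _)
        }
      ; ε-homo = R.trans (R.*-cong H₁.ε-homo H₂.ε-homo) (R.*-identityˡ 1#)
      }
    }
    where
    module τ₁ = TwistMap τ₁
    module τ₂ = TwistMap τ₂
    module H₁ = IsMonoidHomomorphism τ₁.isMonoidHomomorphism
    module H₂ = IsMonoidHomomorphism τ₂.isMonoidHomomorphism

  Tutte : Norm → TwistMap → Norm → Morphism
  Tutte N τ N′ = Norm.morphism N ⋆ twist τ ⋆ Norm.morphism N′

{-# OPTIONS --safe #-}
module Submission where

-- Convolution of morphisms is associative, since both bracketings sum over
-- chains B ⊆ A ⊆ E.  Twist maps multiply pointwise under convolution, because a
-- summand survives only on the empty set, and N * N̄ is the trivial twist map: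
-- by multiplicativity its value at X is N(X) ∑_A (-1)^|E∖A|, which vanishes for
-- E ≠ ∅.  Hence (N̄₀ τ₁ N₁)(N̄₁ τ₂ N₂) = N̄₀ τ₁ (N₁ N̄₁) τ₂ N₂ = N̄₀ (τ₁τ₂) N₂.

open import Algebra.Bundles using (CommutativeMonoid; CommutativeRing)
open import Algebra.Core using (Op₂)
open import Algebra.Structures using (IsSemigroup)
import Algebra.Properties.CommutativeMonoid.Sum as Sum
import Algebra.Properties.CommutativeSemigroup as CommutativeSemigroupProperties
import Algebra.Properties.Ring as RingProperties
import Algebra.Properties.Semiring.Exp as Exp
import Algebra.Properties.Semiring.Sum as SemiringSum
open import Algebra.Module.Bundles using (Module)
open import Algebra.Module.Morphism.Structures using (IsModuleHomomorphism)
open import Algebra.Morphism.Structures using (IsMonoidHomomorphism)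
open import Data.Bool.Base using (Bool; true; false; not; _∧_; T; if_then_else_)
import Data.Bool.Base as Bool
import Data.Bool.Properties as Boolₚ
open import Data.Empty using (⊥-elim)
open import Data.Fin.Base using (Fin; zero; suc; combine; finToFun; punchIn; _↑ˡ_; _↑ʳ_)
open import Data.Fin.Properties using (_≟_; any?; all?; punchInᵢ≢i; remQuot-combine; 2↔Bool)
import Data.Fin.Subset as FS
open import Data.Irrelevant using ([_])
open import Data.Nat.Base using (zero; suc; _^_)
import Data.Nat.Base as ℕ
import Data.Nat.Properties as ℕₚ
open import Data.Product.Base using (_×_; _,_; proj₁; proj₂)
open import Data.Refinement using (Refinement-syntax; value; _,_)
open import Data.Vec.Base using (tabulate)
open import Data.Vec.Properties using (tabulate-cong)
open import Function.Base using (_∘_)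
open import Function.Bundles using (Inverse)
open import Function.Construct.Identity using (↔-id)
open import Level using (Level; _⊔_)
open import Relation.Binary.Bundles using (Setoid)
open import Relation.Binary.Core using (Rel)
import Relation.Binary.PropositionalEquality as ≡
open import Relation.Binary.PropositionalEquality using (_≡_; _≢_; _≗_; cong; subst)
import Relation.Binary.Reasoning.Setoid as SetoidReasoning
open import Relation.Nullary.Decidable using (Dec; yes; no; does; T?; map′; recompute)
open import Relation.Nullary.Negation using (¬_; contradiction)
open import Defs

open Inverse using (to; from; strictlyInverseʳ; strictlyInverseˡ)

-- Finite sums in a commutative monoid.

module FiniteSums {c ℓ} (M : CommutativeMonoid c ℓ) where
  open CommutativeMonoid M renaming (Carrier to C; _∙_ to _+_; ε to 0#; ∙-cong to +-cong; ∙-congˡ to +-congˡ)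
  open Sum M
  open SetoidReasoning setoid

  -- A condition on an index becomes a zero summand, so that dependent ranges of summation turn
  -- rectangular and two sums can be exchanged.
  guard : ∀ {p} {P : Set p} → Dec P → C → C
  guard d x = if does d then x else 0#

  guard-yes : ∀ {p} {P : Set p} (d : Dec P) x → P → guard d x ≈ x
  guard-yes (yes _) x _ = refl
  guard-yes (no ¬p) x p = contradiction p ¬p

  guard-no : ∀ {p} {P : Set p} (d : Dec P) x → ¬ P → guard d x ≈ 0#
  guard-no (yes p) x ¬p = contradiction p ¬p
  guard-no (no _)  x _  = refl

  sum-zero : ∀ {n} (f : Fin n → C) → (∀ i → f i ≈ 0#) → sum f ≈ 0#
  sum-zero {n} f h = trans (sum-cong-≋ h) (sum-replicate-zero n)

  sum-single : ∀ {n} (f : Fin n → C) i → (∀ j → j ≢ i → f j ≈ 0#) → sum f ≈ f i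
  sum-single {suc n} f i h = begin
    sum f                        ≈⟨ sum-remove f ⟩
    f i + sum (f ∘ punchIn i)    ≈⟨ +-congˡ (sum-zero _ (λ j → h (punchIn i j) (punchInᵢ≢i i j))) ⟩
    f i + 0#                     ≈⟨ identityʳ _ ⟩
    f i                          ∎

  -- Double counting over the graph of `φ`: the term `f i` is placed at the pair `(i , φ i)`; the
  -- rows add up to `sum f`, the columns to `sum g`.
  sum-injection : ∀ {m n} (φ : Fin m → Fin n) → (∀ i j → φ i ≡ φ j → i ≡ j) →
                  (f : Fin m → C) (g : Fin n → C) → (∀ i → f i ≈ g (φ i)) →
                  (∀ j → (∀ i → φ i ≢ j) → g j ≈ 0#) → sum f ≈ sum g
  sum-injection φ φ-injective f g f≈gφ g-vanishes = begin
    sum f                                           ≈⟨ sum-cong-≋ row ⟨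
    sum (λ i → sum (λ j → guard (φ i ≟ j) (f i)))   ≈⟨ ∑-comm (λ i j → guard (φ i ≟ j) (f i)) ⟩
    sum (λ j → sum (λ i → guard (φ i ≟ j) (f i)))   ≈⟨ sum-cong-≋ column ⟩
    sum g                                           ∎
    where
    row : ∀ i → sum (λ j → guard (φ i ≟ j) (f i)) ≈ f i
    row i = trans
      (sum-single _ (φ i) (λ j j≢ → guard-no (φ i ≟ j) (f i) (j≢ ∘ ≡.sym)))
      (guard-yes (φ i ≟ φ i) (f i) ≡.refl)
    column : ∀ j → sum (λ i → guard (φ i ≟ j) (f i)) ≈ g j
    -- Injectivity leaves at most one `i` over `j`; where there is none, `g j` is zero by
    -- hypothesis.
    column j with any? (λ i → φ i ≟ j)
    ... | yes (i , ≡.refl) = trans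
      (sum-single _ i (λ i′ i′≢ → guard-no (φ i′ ≟ φ i) (f i′) (i′≢ ∘ φ-injective i′ i)))
      (trans (guard-yes (φ i ≟ φ i) (f i) ≡.refl) (f≈gφ i))
    ... | no ∄i = trans
      (sum-zero _ (λ i → guard-no (φ i ≟ j) (f i) (λ p → ∄i (i , p))))
      (sym (g-vanishes j (λ i p → ∄i (i , p))))

  sum-↑ : ∀ m {n} (f : Fin (m ℕ.+ n) → C) → sum f ≈ sum (f ∘ (_↑ˡ n)) + sum (f ∘ (m ↑ʳ_))
  sum-↑ zero    f = sym (identityˡ _)
  sum-↑ (suc m) f = trans (+-congˡ (sum-↑ m (f ∘ suc))) (sym (assoc _ _ _))

  sum-combine : ∀ m {n} (f : Fin (m ℕ.* n) → C) → sum f ≈ sum (λ i → sum (λ j → f (combine {m} i j)))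
  sum-combine zero        f = refl
  sum-combine (suc m) {n} f = trans (sum-↑ n f) (+-congˡ (sum-combine m (f ∘ (n ↑ʳ_))))

module _ {a ℓ} {A : Set a} {_≈_ : Rel A ℓ} {_∙_ : Op₂ A} (isSemigroup : IsSemigroup _≈_ _∙_) where
  open IsSemigroup isSemigroup
  open SetoidReasoning setoid

  -- The left side is bracketed as a product of two Tutte characters. The element `i` stands for the
  -- trivial twist map, which the twist map `u` absorbs.
  cancel-middle : ∀ x y z w u v i t → (z ∙ w) ≈ i → (i ∙ u) ≈ u → (y ∙ u) ≈ t →
                  (((x ∙ y) ∙ z) ∙ ((w ∙ u) ∙ v)) ≈ ((x ∙ t) ∙ v)
  cancel-middle x y z w u v i t zw≈i iu≈u yu≈t = begin
    ((x ∙ y) ∙ z) ∙ ((w ∙ u) ∙ v)   ≈⟨ assoc _ _ _ ⟨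
    (((x ∙ y) ∙ z) ∙ (w ∙ u)) ∙ v   ≈⟨ ∙-congʳ (assoc _ _ _) ⟩
    ((x ∙ y) ∙ (z ∙ (w ∙ u))) ∙ v   ≈⟨ ∙-congʳ (∙-congˡ (assoc _ _ _)) ⟨
    ((x ∙ y) ∙ ((z ∙ w) ∙ u)) ∙ v   ≈⟨ ∙-congʳ (∙-congˡ (∙-congʳ zw≈i)) ⟩
    ((x ∙ y) ∙ (i ∙ u)) ∙ v         ≈⟨ ∙-congʳ (∙-congˡ iu≈u) ⟩
    ((x ∙ y) ∙ u) ∙ v               ≈⟨ ∙-congʳ (assoc _ _ _) ⟩
    (x ∙ (y ∙ u)) ∙ v               ≈⟨ ∙-congʳ (∙-congˡ yu≈t) ⟩
    (x ∙ t) ∙ v                     ∎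

-- Subsets: containment, extension by a constant, difference.

module _ {X : Set} where

  _⊆_ : (B A : X → Bool) → Set
  B ⊆ A = ∀ e → B e Bool.≤ A e

  Constant : Bool → (X → Bool) → (X → Bool) → Set
  Constant z P B = ∀ e → ¬ T (P e) → B e ≡ z

  ⊆⇒constant-false : ∀ {A B} → B ⊆ A → Constant false A B
  ⊆⇒constant-false {A} {B} h e ¬a with B e | A e | h e
  ... | false | _     | _        = ≡.refl
  ... | true  | true  | Bool.b≤b = ⊥-elim (¬a _)

  constant-false⇒⊆ : ∀ {A B} → Constant false A B → B ⊆ A
  constant-false⇒⊆ {A} {B} h e with A e | B e | h e
  ... | true  | true  | _ = Bool.b≤b
  ... | true  | false | _ = Bool.f≤t
  ... | false | b     | p with p (λ ())
  ...   | ≡.refl = Bool.b≤b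

  ⊆⇒constant-true : ∀ {A B} → B ⊆ A → Constant true (∁ B) A
  ⊆⇒constant-true {A} {B} h e ¬b with B e | A e | h e
  ... | true  | true | Bool.b≤b = ≡.refl
  ... | false | _    | _        = ⊥-elim (¬b _)

  constant-true⇒⊆ : ∀ {A B} → Constant true (∁ B) A → B ⊆ A
  constant-true⇒⊆ {A} {B} h e with A e | B e | h e
  ... | true  | true  | _ = Bool.b≤b
  ... | true  | false | _ = Bool.f≤t
  ... | false | false | _ = Bool.b≤b
  ... | false | true  | p with p (λ ())
  ...   | ()

  -- A section of `inside P`; up to `_≗_` its image consists of the sets that are constantly `z`
  -- outside `P`.
  extend : Bool → (P : X → Bool) → ([ e ∈ X ∣ T (P e) ] → Bool) → X → Bool
  extend z P C e with T? (P e)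
  ... | yes p = C (e , [ p ])
  ... | no _  = z

  extend-constant : ∀ z P C → Constant z P (extend z P C)
  extend-constant z P C e ¬p with T? (P e)
  ... | yes p = contradiction p ¬p
  ... | no _  = ≡.refl

  inside-extend : ∀ z P C → inside P (extend z P C) ≗ C
  inside-extend z P C (e , [ p ]) with T? (P e)
  ... | yes _ = ≡.refl
  ... | no ¬p = contradiction (recompute (T? (P e)) p) ¬p

  extend-inside : ∀ z P B → Constant z P B → extend z P (inside P B) ≗ B
  extend-inside z P B h e with T? (P e)
  ... | yes _ = ≡.refl
  ... | no ¬p = ≡.sym (h e ¬p)

  extend-cong : ∀ z P {C D} → C ≗ D → extend z P C ≗ extend z P D
  extend-cong z P h e with T? (P e)
  ... | yes p = h (e , [ p ])
  ... | no _  = ≡.refl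

  infixl 6 _∖_
  -- The axioms for iterated minors speak of disjoint sets, so a chain `B ⊆ A` enters them as the
  -- pair `B`, `A ∖ B`.
  _∖_ : (A B : X → Bool) → X → Bool
  (A ∖ B) e = A e ∧ not (B e)

  disjoint-∖ : ∀ A B → Disjoint B (A ∖ B)
  disjoint-∖ A B e with A e | B e
  ... | true  | true  = ≡.refl
  ... | true  | false = ≡.refl
  ... | false | true  = ≡.refl
  ... | false | false = ≡.refl

  ∪-∖ : ∀ {A B} → B ⊆ A → A ≗ B ∪ (A ∖ B)
  ∪-∖ {A} {B} h e with B e | A e | h e
  ... | true  | true  | _ = ≡.refl
  ... | false | true  | _ = ≡.refl
  ... | false | false | _ = ≡.refl

  inside-∖ : ∀ A B → inside (∁ B) (A ∖ B) ≗ inside (∁ B) A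
  inside-∖ A B (e , [ p ]) = absorb (A e) (B e) (recompute (T? _) p)
    where
    absorb : ∀ a b → T (not b) → a ∧ not b ≡ a
    absorb true  false _ = ≡.refl
    absorb false false _ = ≡.refl

_⊆?_ : ∀ {E} (B A : Subset E) → Dec (B ⊆ A)
_⊆?_ {E} B A = map′
  (λ h e → subst (λ x → B x Bool.≤ A x) (strictlyInverseʳ (enum E) e) (h (to (enum E) e)))
  (λ h i → h (from (enum E) i))
  (all? (λ i → B (from (enum E) i) Boolₚ.≤? A (from (enum E) i)))

module Convolution
  {k ℓk s ℓs r ℓr} (K : CommutativeRing k ℓk) (S : MinorsSystem s ℓs)
  (R : CommutativeAlgebra K r ℓr) where

  open TutteCharacters K S R
  open MinorsSystem S hiding (Str; _∣_; _/_)
  private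
    module R = CommutativeAlgebra R
    module RM = Module R.asModule
    module ≈-Reasoning = SetoidReasoning R.setoid
  open Sum R.+-commutativeMonoid using (sum; sum-cong-≋; ∑-comm)
  open SemiringSum R.semiring using (*-distribˡ-sum; *-distribʳ-sum)
  open FiniteSums R.+-commutativeMonoid

  -- Sums over subsets.

  ∑⊆-distribˡ : ∀ E x (f : Subset E → ∣R∣) → x * ∑⊆ E f ≈ ∑[ A ⊆ E ] (x * f A)
  ∑⊆-distribˡ E x f = *-distribˡ-sum x (f ∘ nthSubset E)

  ∑⊆-distribʳ : ∀ E x (f : Subset E → ∣R∣) → ∑⊆ E f * x ≈ ∑[ A ⊆ E ] (f A * x)
  ∑⊆-distribʳ E x f = *-distribʳ-sum x (f ∘ nthSubset E)

  -- Subsets of P correspond to the subsets of E that are constantly z outside P: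
  -- for z = false those contained in P, for z = true those containing E ∖ P.
  ∑⊆-Sub : ∀ E (P : Subset E) z (f : Subset (Sub E P) → ∣R∣) (g : Subset E → ∣R∣) →
           (∀ C B → Constant z P B → C ≗ inside P B → f C ≈ g B) →
           (∀ B → ¬ Constant z P B → g B ≈ 0#) →
           ∑⊆ (Sub E P) f ≈ ∑⊆ E g
  ∑⊆-Sub E P z f g f≈g g-vanishes = sum-injection φ φ-injective _ _
    (λ i → f≈g _ _
      (λ e ¬p → ≡.trans (nth-φ i e) (extend-constant z P _ e ¬p))
      (λ x → ≡.sym (≡.trans (nth-φ i (value x)) (inside-extend z P _ x))))
    (λ j ∄i → g-vanishes (nthSubset E j) (λ const → ∄i (ψ j) (φ∘ψ j const)))
    where
    φ : Fin (2 ^ size (Sub E P)) → Fin (2 ^ size E)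
    φ i = indexOf E (extend z P (nthSubset (Sub E P) i))
    ψ : Fin (2 ^ size E) → Fin (2 ^ size (Sub E P))
    ψ j = indexOf (Sub E P) (inside P (nthSubset E j))
    nth-φ : ∀ i → nthSubset E (φ i) ≗ extend z P (nthSubset (Sub E P) i)
    nth-φ i = nthSubset-indexOf E _
    ψ∘φ : ∀ i → ψ (φ i) ≡ i
    ψ∘φ i = ≡.trans
      (indexOf-cong (Sub E P) (λ x → ≡.trans (nth-φ i (value x)) (inside-extend z P _ x)))
      (indexOf-nthSubset (Sub E P) i)
    φ-injective : ∀ i j → φ i ≡ φ j → i ≡ j
    φ-injective i j p = ≡.trans (≡.sym (ψ∘φ i)) (≡.trans (cong ψ p) (ψ∘φ j))
    φ∘ψ : ∀ j → Constant z P (nthSubset E j) → φ (ψ j) ≡ j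
    φ∘ψ j const = ≡.trans
      (indexOf-cong E (λ e → ≡.trans
        (extend-cong z P (nthSubset-indexOf (Sub E P) (inside P (nthSubset E j))) e)
        (extend-inside z P _ const e)))
      (indexOf-nthSubset E j)

  -- Structures and morphisms up to relabelling.

  infix 4 _~_
  -- Minors that agree in set theory live here on ground sets that are only in bijection. Chains of
  -- such identifications are composed in `R`, after a morphism is applied.
  record _~_ {E F} (X : Str E) (Y : Str F) : Set ℓs where
    constructor along
    field
      bijection : E ≅ F
      matches   : relabel {E} {F} bijection X ≈ˢ Y

  open _~_

  ~-refl : ∀ {E} {X : Str E} → X ~ X
  ~-refl {E} {X} = along (↔-id (Elem E)) (relabel-id X)

  -- At `~-refl` the hypothesis on `A` and `B` is `A ≗ B`, so this also exchanges pointwise equal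
  -- subsets.
  ~-∣ : ∀ {E F} {X : Str E} {Y : Str F} (p : X ~ Y) (A : Subset E) (B : Subset F) →
        A ≗ B ∘ to (bijection p) → X ∣ A ~ Y ∣ B
  ~-∣ {E} {F} {X} (along σ m) A B h = along (restrict≅ {E} {F} σ A B h)
    (Setoid.trans (on (Sub F B)) (∣-relabel {E} {F} σ A B h X) (∣-cong {F} B m))

  ~-/ : ∀ {E F} {X : Str E} {Y : Str F} (p : X ~ Y) (A : Subset E) (B : Subset F) →
        A ≗ B ∘ to (bijection p) → X / A ~ Y / B
  ~-/ {E} {F} {X} (along σ m) A B h = along (restrict≅ {E} {F} σ (∁ A) (∁ B) (cong not ∘ h))
    (Setoid.trans (on (Sub F (∁ B))) (/-relabel {E} {F} σ A B h X) (/-cong {F} B m))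

  at-~ : ∀ f {E F} {X : Str E} {Y : Str F} → X ~ Y → f at X ≈ f at Y
  at-~ f {E} {F} (along σ m) = Morphism.value-relabel f {E} {F} σ m

  infix 4 _≈ᵐ_
  -- Convolution evaluates its factors on generators only, so the semigroup laws can be stated for
  -- this relation; linearity then gives `_≋_`.
  record _≈ᵐ_ (f g : Morphism) : Set (Level.suc Level.zero ⊔ s ⊔ ℓr) where
    constructor pointwise
    field
      at-≈ : ∀ {E} (X : Str E) → f at X ≈ g at X

  open _≈ᵐ_ public

  ≈ᵐ⇒≋ : ∀ {f g} → f ≈ᵐ g → f ≋ g
  ≈ᵐ⇒≋ {f} {g} h E = go
    where
    module F = IsModuleHomomorphism (Morphism.linear f {E})
    module G = IsModuleHomomorphism (Morphism.linear g {E})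
    go : ∀ u → Morphism.⟦_⟧ f {E} u ≈ Morphism.⟦_⟧ g {E} u
    go Free.⟨ X ⟩     = at-≈ h X
    go Free.𝟘         = R.trans F.0ᴹ-homo (R.sym G.0ᴹ-homo)
    go (u Free.⊞ v)   = R.trans (F.+ᴹ-homo u v) (R.trans (R.+-cong (go u) (go v)) (R.sym (G.+ᴹ-homo u v)))
    go (Free.⊟ u)     = R.trans (F.-ᴹ-homo u) (R.trans (R.-‿cong (go u)) (R.sym (G.-ᴹ-homo u)))
    go (c Free.⊡ u)   = R.trans (F.*ₗ-homo c u) (R.trans (RM.*ₗ-congˡ (go u)) (R.sym (G.*ₗ-homo c u)))

  ⋆-cong : ∀ {f f′ g g′} → f ≈ᵐ f′ → g ≈ᵐ g′ → f ⋆ g ≈ᵐ f′ ⋆ g′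
  ⋆-cong p q = pointwise (λ {E} X → sum-cong-≋ (λ i →
    R.*-cong (at-≈ p (X ∣ nthSubset E i)) (at-≈ q (X / nthSubset E i))))

  -- Minors along a chain of subsets.

  module _ {E} (X : Str E) {B A : Subset E} (B⊆A : B ⊆ A) where
    open ≈-Reasoning

    private
      d = disjoint-∖ A B
      A≗ = ∪-∖ {A = A} {B} B⊆A

    -- This is `∣-∣` for `B` and `A ∖ B`, whose union is `A`. The set `B′` is free up to `_≗_`
    -- because reindexing determines subsets only pointwise.
    minor-∣∣ : ∀ f B′ → B′ ≗ inside A B → f at (X ∣ A ∣ B′) ≈ f at (X ∣ B)
    minor-∣∣ f B′ h = R.trans
      (at-~ f (~-∣ (~-∣ ~-refl A (B ∪ (A ∖ B)) A≗) B′ (inside (B ∪ (A ∖ B)) B) h))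
      (at-~ f (along (in∪≅ E B (A ∖ B) d) (∣-∣ {E} B (A ∖ B) d X)))

    -- Both minors have ground set `A ∖ B` up to bijection, and there `/-∣` identifies them.
    minor-∣/ : ∀ f B′ → B′ ≗ inside A B → f at (X ∣ A / B′) ≈ f at (X / B ∣ inside (∁ B) A)
    minor-∣/ f B′ h = begin
      f at (X ∣ A / B′)
        ≈⟨ at-~ f (~-/ (~-∣ ~-refl A (B ∪ (A ∖ B)) A≗) B′ (inside (B ∪ (A ∖ B)) B) h) ⟩
      f at (X ∣ (B ∪ (A ∖ B)) / inside (B ∪ (A ∖ B)) B)
        ≈⟨ at-~ f (along (∪∖≅ E B (A ∖ B) d) (Setoid.refl (on (Sub E (A ∖ B))))) ⟩
      f at (relabel (∪∖≅ E B (A ∖ B) d) (X ∣ (B ∪ (A ∖ B)) / inside (B ∪ (A ∖ B)) B))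
        ≈⟨ at-~ f (along {Sub (Sub E (∁ B)) (inside (∁ B) (A ∖ B))} {Sub E (A ∖ B)}
             (in∁≅ E B (A ∖ B) d) (/-∣ {E} B (A ∖ B) d X)) ⟨
      f at (X / B ∣ inside (∁ B) (A ∖ B))
        ≈⟨ at-~ f (~-∣ ~-refl (inside (∁ B) (A ∖ B)) (inside (∁ B) A) (inside-∖ A B)) ⟩
      f at (X / B ∣ inside (∁ B) A) ∎

    minor-// : ∀ f C′ → C′ ≗ inside (∁ B) A → f at (X / B / C′) ≈ f at (X / A)
    minor-// f C′ h = begin
      f at (X / B / C′)
        ≈⟨ at-~ f (~-/ ~-refl C′ (inside (∁ B) (A ∖ B)) (λ x → ≡.trans (h x) (≡.sym (inside-∖ A B x)))) ⟩
      f at (X / B / inside (∁ B) (A ∖ B))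
        ≈⟨ at-~ f (along (∖∖≅ E B (A ∖ B) d) (/-/ {E} B (A ∖ B) d X)) ⟩
      f at (X / (B ∪ (A ∖ B)))
        ≈⟨ at-~ f (~-/ ~-refl A (B ∪ (A ∖ B)) A≗) ⟨
      f at (X / A) ∎

  -- Associativity of convolution.

  module _ (f g h : Morphism) {E} (X : Str E) where
    open ≈-Reasoning

    private
      -- The factor of `g` lives between `B` and `A` and is written as a minor of `X / B`, a form
      -- that both bracketings can be brought to. The guard lets `A` and `B` range independently.
      term chain : Subset E → Subset E → ∣R∣
      term B A = f at (X ∣ B) * g at (X / B ∣ inside (∁ B) A) * h at (X / A)
      chain B A = guard (_⊆?_ {E} B A) (term B A)

    ∑-∣-∑ : ∀ A → (f ⋆ g) at (X ∣ A) * h at (X / A) ≈ ∑[ B ⊆ E ] chain B A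
    ∑-∣-∑ A = R.trans
      (∑⊆-distribʳ (Sub E A) _ (λ B′ → f at (X ∣ A ∣ B′) * g at (X ∣ A / B′)))
      (∑⊆-Sub E A false
        (λ B′ → f at (X ∣ A ∣ B′) * g at (X ∣ A / B′) * h at (X / A)) (λ B → chain B A)
        (λ B′ B const p → let B⊆A = constant-false⇒⊆ {A = A} {B} const in R.trans
          (R.*-congʳ (R.*-cong (minor-∣∣ X B⊆A f B′ p) (minor-∣/ X B⊆A g B′ p)))
          (R.sym (guard-yes (_⊆?_ {E} B A) (term B A) B⊆A)))
        (λ B ¬const → guard-no (_⊆?_ {E} B A) (term B A) (¬const ∘ ⊆⇒constant-false)))

    ∑-/-∑ : ∀ B → f at (X ∣ B) * (g ⋆ h) at (X / B) ≈ ∑[ A ⊆ E ] chain B A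
    ∑-/-∑ B = R.trans
      (∑⊆-distribˡ (Sub E (∁ B)) _ (λ C → g at (X / B ∣ C) * h at (X / B / C)))
      -- A subset `C` of the complement of `B` stands for the union of `B` and `C`, hence the
      -- constant `true` on `B`.
      (∑⊆-Sub E (∁ B) true
        (λ C → f at (X ∣ B) * (g at (X / B ∣ C) * h at (X / B / C))) (chain B)
        (λ C A const p → let B⊆A = constant-true⇒⊆ {A = A} {B} const in begin
          f at (X ∣ B) * (g at (X / B ∣ C) * h at (X / B / C))
            ≈⟨ R.*-congˡ (R.*-cong (at-~ g (~-∣ ~-refl C (inside (∁ B) A) p)) (minor-// X B⊆A h C p)) ⟩
          f at (X ∣ B) * (g at (X / B ∣ inside (∁ B) A) * h at (X / A))
            ≈⟨ R.*-assoc _ _ _ ⟨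
          term B A
            ≈⟨ guard-yes (_⊆?_ {E} B A) (term B A) B⊆A ⟨
          chain B A ∎)
        (λ A ¬const → guard-no (_⊆?_ {E} B A) (term B A) (¬const ∘ ⊆⇒constant-true)))

    ⋆-assoc-at : ((f ⋆ g) ⋆ h) at X ≈ (f ⋆ (g ⋆ h)) at X
    ⋆-assoc-at = begin
      ∑⊆ E (λ A → (f ⋆ g) at (X ∣ A) * h at (X / A))   ≈⟨ sum-cong-≋ (λ i → ∑-∣-∑ (nthSubset E i)) ⟩
      ∑⊆ E (λ A → ∑[ B ⊆ E ] chain B A)                ≈⟨ ∑-comm (λ i j → chain (nthSubset E j) (nthSubset E i)) ⟩
      ∑⊆ E (λ B → ∑[ A ⊆ E ] chain B A)                ≈⟨ sum-cong-≋ (λ j → ∑-/-∑ (nthSubset E j)) ⟨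
      ∑⊆ E (λ B → f at (X ∣ B) * (g ⋆ h) at (X / B))   ∎

  ⋆-isSemigroup : IsSemigroup _≈ᵐ_ _⋆_
  ⋆-isSemigroup = record
    { isMagma = record
      { isEquivalence = record
        { refl  = pointwise (λ _ → R.refl)
        ; sym   = λ p → pointwise (λ X → R.sym (at-≈ p X))
        ; trans = λ p q → pointwise (λ X → R.trans (at-≈ p X) (at-≈ q X)) }
      ; ∙-cong = ⋆-cong }
    ; assoc = λ f g h → pointwise (⋆-assoc-at f g h) }

  -- Values on the empty ground set and products of twist maps.

  ~-∅ : ∀ {E} (X : Str E) (p : size E ≡ 0) → X ~ relabel {E} {∅} (empty≅∅ E p) X
  ~-∅ {E} X p = along (empty≅∅ E p) (Setoid.refl (on ∅))

  minor-∣-full : ∀ f {E} (X : Str E) A → A ≗ full → f at (X ∣ A) ≈ f at X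
  minor-∣-full f {E} X A h = R.trans (at-~ f (~-∣ ~-refl A full h))
    (at-~ f (along (whole≅ E full (λ _ → ≡.refl)) (∣-full X)))

  minor-/-none : ∀ f {E} (X : Str E) A → A ≗ none → f at (X / A) ≈ f at X
  minor-/-none f {E} X A h = R.trans (at-~ f (~-/ ~-refl A none h))
    (at-~ f (along (whole≅ E (∁ none) (λ _ → ≡.refl)) (/-none X)))

  -- The only subset of `∅` is both full and empty, so one summand remains and both of its minors
  -- reduce to `X`.
  ⋆-∅ : ∀ f g (X : Str ∅) → (f ⋆ g) at X ≈ f at X * g at X
  ⋆-∅ f g X = R.trans (R.+-identityʳ _) (R.*-cong
    (minor-∣-full f X (nthSubset ∅ zero) (λ ())) (minor-/-none g X (nthSubset ∅ zero) (λ ())))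

  -- Invariance moves every structure on a ground set of size zero to `∅`.
  ≈ᵐ-cases : ∀ {f g} → (∀ (X : Str ∅) → f at X ≈ g at X) →
             (∀ {E} (X : Str E) → size E ≢ 0 → f at X ≈ g at X) → f ≈ᵐ g
  ≈ᵐ-cases {f} {g} empty nonempty = pointwise (λ {E} X → cases X (size E ℕₚ.≟ 0))
    where
    cases : ∀ {E} (X : Str E) → Dec (size E ≡ 0) → f at X ≈ g at X
    cases X (yes p) = R.trans (at-~ f (~-∅ X p)) (R.trans (empty _) (R.sym (at-~ g (~-∅ X p))))
    cases X (no ¬p) = nonempty X ¬p

  twist-∅ : ∀ τ (X : Str ∅) → twist τ at X ≈ TwistMap.onEmpty τ X
  twist-∅ τ X = IsMonoidHomomorphism.⟦⟧-cong (TwistMap.isMonoidHomomorphism τ) (relabel-id X)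

  twist-nonempty : ∀ τ {E} (X : Str E) → size E ≢ 0 → twist τ at X ≈ 0#
  twist-nonempty τ {E} X ¬p with size E ℕₚ.≟ 0
  ... | yes p = contradiction p ¬p
  ... | no _  = R.refl

  twist-⋆ : ∀ τ₁ τ₂ → twist τ₁ ⋆ twist τ₂ ≈ᵐ twist (τ₁ ∙ τ₂)
  twist-⋆ τ₁ τ₂ = ≈ᵐ-cases
    (λ X → R.trans (⋆-∅ (twist τ₁) (twist τ₂) X)
      (R.trans (R.*-cong (twist-∅ τ₁ X) (twist-∅ τ₂ X)) (R.sym (twist-∅ (τ₁ ∙ τ₂) X))))
    (λ {E} X ¬p → R.trans (sum-zero _ (λ i → vanishes X ¬p (nthSubset E i)))
      (R.sym (twist-nonempty (τ₁ ∙ τ₂) X ¬p)))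
    where
    -- The sizes of `A` and its complement add up to `size E`, so one of them is nonempty and its
    -- factor is zero.
    vanishes : ∀ {E} (X : Str E) → size E ≢ 0 → ∀ A → twist τ₁ at (X ∣ A) * twist τ₂ at (X / A) ≈ 0#
    vanishes {E} X ¬p A = cases (size (Sub E A) ℕₚ.≟ 0)
      where
      cases : Dec (size (Sub E A) ≡ 0) → twist τ₁ at (X ∣ A) * twist τ₂ at (X / A) ≈ 0#
      cases (no ¬q) = R.trans (R.*-congʳ (twist-nonempty τ₁ (X ∣ A) ¬q)) (R.zeroˡ _)
      cases (yes q) = R.trans
        (R.*-congˡ (twist-nonempty τ₂ (X / A)
          (λ q′ → ¬p (≡.trans (≡.sym (size-Sub E A)) (≡.cong₂ ℕ._+_ q q′)))))
        (R.zeroʳ _)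

  twist-cong : ∀ τ₁ τ₂ → (∀ X → TwistMap.onEmpty τ₁ X ≈ TwistMap.onEmpty τ₂ X) → twist τ₁ ≈ᵐ twist τ₂
  twist-cong τ₁ τ₂ h = ≈ᵐ-cases
    (λ X → R.trans (twist-∅ τ₁ X) (R.trans (h X) (R.sym (twist-∅ τ₂ X))))
    (λ X ¬p → R.trans (twist-nonempty τ₁ X ¬p) (R.sym (twist-nonempty τ₂ X ¬p)))

  trivial : TwistMap
  trivial = record
    { onEmpty = λ _ → 1#
    ; isMonoidHomomorphism = record
      { isMagmaHomomorphism = record
        { isRelHomomorphism = record { cong = λ _ → R.refl }
        ; homo = λ _ _ → R.sym (R.*-identityˡ 1#) }
      ; ε-homo = R.refl } }

  -- Commutativity makes `X` the summand of `1ˢ ⊕ X` that the norm ignores.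
  norm-∅ : ∀ N (X : Str ∅) → Norm.morphism N at X ≈ 1#
  norm-∅ N X = begin
    morphism at X          ≈⟨ Morphism.value-cong morphism {∅} (⊕-identityʳ X) ⟨
    morphism at (X ⊕ 1ˢ)   ≈⟨ Morphism.value-cong morphism {∅} (⊕-comm X 1ˢ) ⟩
    morphism at (1ˢ ⊕ X)   ≈⟨ ⊕-invariant 1ˢ X ⟩
    morphism at 1ˢ         ≈⟨ normalised ⟩
    1#                     ∎
    where
    open Norm N
    open ≈-Reasoning

  -- The alternating sum over subsets and the product of a norm with its inverse.

  open Exp R.semiring using () renaming (_^_ to _↑_)
  open RingProperties R.ring using (-1*x≈-x)

  -- (-1)^|E∖A| for the subset A of an n-element set E coded by b.
  sign : ∀ n → (Fin n → Fin 2) → ∣R∣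
  sign n b = (- 1#) ↑ FS.∣ tabulate (not ∘ to 2↔Bool ∘ b) ∣

  sign-cong : ∀ {n} {b c : Fin n → Fin 2} → b ≗ c → sign n b ≈ sign n c
  sign-cong h = R.reflexive (cong (λ v → (- 1#) ↑ FS.∣ v ∣) (tabulate-cong (cong (not ∘ to 2↔Bool) ∘ h)))

  -- Adding the first element to a subset reverses the sign, so the subsets with it and those
  -- without it cancel.
  sign-sum : ∀ n → n ≢ 0 → sum (λ (i : Fin (2 ^ n)) → sign n (finToFun i)) ≈ 0#
  sign-sum zero    n≢0 = contradiction ≡.refl n≢0
  sign-sum (suc n) _   = begin
    sum (λ i → sign (suc n) (finToFun {2} {suc n} i))
      ≈⟨ sum-combine 2 {2 ^ n} (λ i → sign (suc n) (finToFun {2} {suc n} i)) ⟩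
    half zero R.+ (half (suc zero) R.+ 0#)
      -- The digit `zero` means absence from the subset: the complement gains an element, which
      -- gives the factor `- 1#`. The digit `suc zero` leaves the sign alone.
      ≈⟨ R.+-cong (R.trans (split zero) (R.sym (*-distribˡ-sum (- 1#) signs)))
                  (R.trans (R.+-identityʳ _) (split (suc zero))) ⟩
    - 1# * sum signs R.+ sum signs
      ≈⟨ R.+-congʳ (-1*x≈-x _) ⟩
    - sum signs R.+ sum signs
      ≈⟨ R.-‿inverseˡ _ ⟩
    0# ∎
    where
    open ≈-Reasoning
    signs : Fin (2 ^ n) → ∣R∣
    signs j = sign n (finToFun j)
    half : Fin 2 → ∣R∣
    half b = sum (λ j → sign (suc n) (finToFun {2} {suc n} (combine {2} {2 ^ n} b j)))
    cons : Fin 2 × Fin (2 ^ n) → Fin (suc n) → Fin 2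
    cons (b , j) zero    = b
    cons (b , j) (suc l) = finToFun j l
    finToFun-cons : ∀ b j → finToFun {2} {suc n} (combine {2} {2 ^ n} b j) ≗ cons (b , j)
    finToFun-cons b j zero    = cong proj₁ (remQuot-combine {2} {2 ^ n} b j)
    finToFun-cons b j (suc l) = cong (λ p → finToFun (proj₂ p) l) (remQuot-combine {2} {2 ^ n} b j)
    split : ∀ b → half b ≈ sum (λ j → sign (suc n) (cons (b , j)))
    split b = sum-cong-≋ {2 ^ n} (λ j → sign-cong (finToFun-cons b j))

  norm-⋆-inverse : ∀ N → Norm.morphism N ⋆ Norm.morphism (inverse N) ≈ᵐ twist trivial
  norm-⋆-inverse N = ≈ᵐ-cases
    (λ X → begin
      (M ⋆ Norm.morphism (inverse N)) at X         ≈⟨ ⋆-∅ M (Norm.morphism (inverse N)) X ⟩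
      M at X * Norm.morphism (inverse N) at X      ≈⟨ R.*-cong (norm-∅ N X) (norm-∅ (inverse N) X) ⟩
      1# * 1#                                      ≈⟨ R.*-identityˡ 1# ⟩
      1#                                           ≈⟨ twist-∅ trivial X ⟨
      twist trivial at X                           ∎)
    (λ {E} X ¬p → begin
      ∑⊆ E (λ A → M at (X ∣ A) * ((- 1#) ↑ size (Sub E (∁ A)) * M at (X / A)))
        ≈⟨ sum-cong-≋ (λ i → factor X (nthSubset E i)) ⟩
      ∑⊆ E (λ A → M at X * (- 1#) ↑ size (Sub E (∁ A)))
        ≈⟨ ∑⊆-distribˡ E (M at X) (λ A → (- 1#) ↑ size (Sub E (∁ A))) ⟨
      M at X * ∑⊆ E (λ A → (- 1#) ↑ size (Sub E (∁ A)))
        -- The size of a `Sub` is counted along `from (enum E)`, while `nthSubset` reads digits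
        -- along `to (enum E)`; the round trip leaves the digits of `i`.
        ≈⟨ R.*-congˡ (sum-cong-≋ (λ i → sign-cong
             (cong (finToFun {2} {size E} i) ∘ strictlyInverseˡ (enum E)))) ⟩
      M at X * sum (λ (i : Fin (2 ^ size E)) → sign (size E) (finToFun i))
        ≈⟨ R.*-congˡ (sign-sum (size E) ¬p) ⟩
      M at X * 0#
        ≈⟨ R.zeroʳ _ ⟩
      0#
        ≈⟨ twist-nonempty trivial X ¬p ⟨
      twist trivial at X ∎)
    where
    open ≈-Reasoning
    M = Norm.morphism N
    open CommutativeSemigroupProperties R.*-commutativeSemigroup using (x∙yz≈xz∙y)
    factor : ∀ {E} (X : Str E) A →
      M at (X ∣ A) * ((- 1#) ↑ size (Sub E (∁ A)) * M at (X / A)) ≈ M at X * (- 1#) ↑ size (Sub E (∁ A))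
    factor X A = R.trans (x∙yz≈xz∙y _ _ _) (R.*-congʳ (R.sym (Norm.multiplicative N X A)))

  -- A case of the product of twist maps, since `trivial` is constantly `1#`; `trivial ∙ τ` and `τ`
  -- agree pointwise.
  twist-identityˡ : ∀ τ → twist trivial ⋆ twist τ ≈ᵐ twist τ
  twist-identityˡ τ = pointwise (λ X → R.trans (at-≈ (twist-⋆ trivial τ) X)
    (at-≈ (twist-cong (trivial ∙ τ) τ (λ _ → R.*-identityˡ _)) X))

theorem3p22 : {k ℓk s ℓs r ℓr : Level} (K : CommutativeRing k ℓk) (S : MinorsSystem s ℓs)
    (R : CommutativeAlgebra K r ℓr) →
    let open TutteCharacters K S R in
    (N₀ N₁ N₂ : Norm) (τ₁ τ₂ : TwistMap) →
    (Tutte (inverse N₀) (τ₁ ∙ τ₂) N₂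
    ≋ Tutte (inverse N₀) τ₁ N₁ ⋆ Tutte (inverse N₁) τ₂ N₂)
    × (∀ E (X : Str E) →
    Tutte (inverse N₀) (τ₁ ∙ τ₂) N₂ at X
    ≈ ∑[ A ⊆ E ] (Tutte (inverse N₀) τ₁ N₁ at (X ∣ A) * Tutte (inverse N₁) τ₂ N₂ at (X / A)))
theorem3p22 K S R N₀ N₁ N₂ τ₁ τ₂ =
  ≈ᵐ⇒≋ {Tutte (inverse N₀) (τ₁ ∙ τ₂) N₂} {Tutte (inverse N₀) τ₁ N₁ ⋆ Tutte (inverse N₁) τ₂ N₂}
    -- On a generator the convolution unfolds to the sum over subsets, so `formula` proves the
    -- second component by conversion and, through linearity, the first.
    (pointwise (formula _)) , formula
  where
  open CommutativeAlgebra R using (sym)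
  open TutteCharacters K S R
  open Convolution K S R
  -- The eta-expansions pointwise (at-≈ …) make conversion compare values only;
  -- comparing the morphisms themselves would unfold their linearity proofs.
  formula : ∀ E (X : Str E) → Tutte (inverse N₀) (τ₁ ∙ τ₂) N₂ at X
    ≈ (Tutte (inverse N₀) τ₁ N₁ ⋆ Tutte (inverse N₁) τ₂ N₂) at X
  formula E X = sym (at-≈ (cancel-middle ⋆-isSemigroup
    (Norm.morphism (inverse N₀)) (twist τ₁) (Norm.morphism N₁)
    (Norm.morphism (inverse N₁)) (twist τ₂) (Norm.morphism N₂)
    (twist trivial) (twist (τ₁ ∙ τ₂))
    (pointwise (at-≈ (norm-⋆-inverse N₁)))
    (pointwise (at-≈ (twist-identityˡ τ₂)))
    (pointwise (at-≈ (twist-⋆ τ₁ τ₂)))) X)
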